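{- Let $p,k,q,n$ be positive integers. If there exist a partition of $\{1,\dots,q\}$ into $n$ weakly sum-free subsets and a partition of $\{1,\dots,p\}$ into $k$ sum-free subsets, then there exists a partition of $\{1,\dots, p(q+\lceil q/2\rceil+1)+q\}$ into $n+k$ weakly sum-free subsets.
   Context: A set $A \subseteq \mathbb{N}$ is sum-free if for all $(a,b)\in A^2$ (allowing $a=b$), $a+b \notin A$. A set $B\subseteq\mathbb{N}$ is weakly sum-free if for all $(a,b)\in B^2$ with $a\neq b$, $a+b\notin B$. -}

module Defs where

open import Data.Fin.Base using (Fin)
open import Data.Nat.Base using (ℕ; _+_; _≤_)
open import Data.Product.Base using (∃-syntax; _×_)
open import Level using (0ℓ)
open import Relation.Binary.PropositionalEquality using (_≢_)
open import Relation.Unary using (Pred; _∈_; _∉_; _≐_; _⊥_; Satisfiable; ⋃)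

SumFree : Pred ℕ 0ℓ → Set
SumFree A = ∀ a b → a ∈ A → b ∈ A → a + b ∉ A

WeaklySumFree : Pred ℕ 0ℓ → Set
WeaklySumFree B = ∀ a b → a ∈ B → b ∈ B → a ≢ b → a + b ∉ B

⟦1⋯_⟧ : ℕ → Pred ℕ 0ℓ
⟦1⋯ m ⟧ x = 1 ≤ x × x ≤ m

record IsPartition (S : Pred ℕ 0ℓ) {n : ℕ} (P : Fin n → Pred ℕ 0ℓ) : Set where
  field
    nonempty : ∀ i → Satisfiable (P i)
    disjoint : ∀ i j → i ≢ j → P i ⊥ P j
    union    : ⋃ (Fin n) P ≐ S

-- `S PartitionableInto n Subsets Q`: some partition of S has exactly n parts,
-- each of them satisfying Q.
_PartitionableInto_Subsets_ : Pred ℕ 0ℓ → ℕ → (Pred ℕ 0ℓ → Set) → Set₁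
S PartitionableInto n Subsets Q =
  ∃[ P ] IsPartition S {n} P × (∀ i → Q (P i))

{-# OPTIONS --safe #-}
-- Let r = ⌈q/2⌉, s = ⌊q/2⌋ and a = q + r + 1. Every x in {1,…,pa+q} is uniquely
-- m a + u with 0 ≤ m ≤ p and −r ≤ u ≤ q. If m ≥ 1 and u ≤ s, colour x by the
-- sum-free class of m; otherwise 1 ≤ u ≤ q, and x gets the weakly sum-free class
-- of u. A monochromatic x + y = z has no carry between remainders and quotients:
-- u + u' and u'' differ by less than a for the classes of m, and u + u' < u'' + a for the
-- classes of u, because u'' > s when m'' ≥ 1. So the relation descends to the m's
-- (which is impossible) or to the u's, where it reads u + u' = u''. The only case
-- not excluded by weak sum-freeness is u = u', but then x ≠ y forces m or m' to be
-- positive, whence u > s and 2u > q ≥ u''.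
module Submission where

open import Defs
open import Data.Empty using (⊥; ⊥-elim)
open import Data.Fin.Base using (Fin; splitAt; join)
open import Data.Fin.Properties using (join-splitAt; splitAt-join) renaming (_≟_ to _≟ᶠ_)
open import Data.Nat.Base
open import Data.Nat.DivMod using (_/_; _%_; m≡m%n+[m/n]*n; m%n<n)
open import Data.Nat.Properties
open import Data.Nat.Tactic.RingSolver using (solve-∀)
open import Data.Product.Base using (∃-syntax; _×_; _,_; proj₁; proj₂)
open import Data.Sum.Base using (_⊎_; inj₁; inj₂)
open import Function.Base using (_∘_)
open import Level using (0ℓ)
open import Relation.Binary.PropositionalEquality
open import Relation.Nullary using (yes; no)
open import Relation.Unary using (Pred; _∈_; Satisfiable)

-- The hypotheses say that `u` and `v` differ by less than `a`; neither has to lie below `a`, so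
-- sums of two remainders can be compared too. Peeling one `a` off both sides reduces to a zero
-- quotient, where a positive quotient opposite it would force a gap of at least `a`.
quotient-unique : ∀ {u v a} m n → u < v + a → v < u + a →
  u + m * a ≡ v + n * a → m ≡ n
quotient-unique zero zero _ _ _ = refl
quotient-unique {u} {v} {a} zero (suc n) u<v+a _ eq = ⊥-elim (<⇒≱ u<v+a (begin
  v + a            ≤⟨ +-monoʳ-≤ v (m≤m+n a (n * a)) ⟩
  v + (a + n * a)  ≡⟨ eq ⟨
  u + 0            ≡⟨ +-identityʳ u ⟩
  u                ∎))
  where open ≤-Reasoning
quotient-unique (suc m) zero u<v+a v<u+a eq =
  sym (quotient-unique zero (suc m) v<u+a u<v+a (sym eq))
quotient-unique {u} {v} {a} (suc m) (suc n) u<v+a v<u+a eq =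
  cong suc (quotient-unique m n u<v+a v<u+a
    (+-cancelˡ-≡ a _ _ (trans (shift a u (m * a)) (trans eq (sym (shift a v (n * a)))))))
  where
  shift : ∀ a u w → a + (u + w) ≡ u + (a + w)
  shift = solve-∀

remainder-unique : ∀ {u v a} m n → u < v + a → v < u + a →
  u + m * a ≡ v + n * a → u ≡ v
remainder-unique {u} {v} {a} m n u<v+a v<u+a eq
  with refl ← quotient-unique m n u<v+a v<u+a eq = +-cancelʳ-≡ (m * a) u v eq

-- By definition both sides are floors, of `suc n` and of `suc (suc n)` halved, so monotonicity
-- suffices.
⌈n/2⌉≤1+⌊n/2⌋ : ∀ n → ⌈ n /2⌉ ≤ suc ⌊ n /2⌋
⌈n/2⌉≤1+⌊n/2⌋ n = ⌊n/2⌋-mono (n≤1+n (suc n))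

+-quotients : ∀ u v m n a → (u + m * a) + (v + n * a) ≡ (u + v) + (m + n) * a
+-quotients = solve-∀

-- Lets the classes be indexed by a disjoint union, which keeps the two kinds apart in case
-- analysis. Disjointness is asked for in the form that an element determines its class.
reindex-splitAt : ∀ {S : Pred ℕ 0ℓ} (Q : Pred ℕ 0ℓ → Set) n k (C : Fin n ⊎ Fin k → Pred ℕ 0ℓ) →
  (∀ c → Satisfiable (C c)) →
  (∀ c d x → x ∈ C c → x ∈ C d → c ≡ d) →
  (∀ c x → x ∈ C c → x ∈ S) →
  (∀ x → x ∈ S → ∃[ c ] x ∈ C c) →
  (∀ c → Q (C c)) →
  S PartitionableInto (n + k) Subsets Q
reindex-splitAt Q n k C satisfiable unique sound complete good =
  C ∘ splitAt n , record
    { nonempty = λ i → satisfiable (splitAt n i)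
    ; disjoint = λ i j i≢j {x} (x∈i , x∈j) → i≢j (trans (sym (join-splitAt n k i))
        (trans (cong (join n k) (unique _ _ x x∈i x∈j)) (join-splitAt n k j)))
    ; union = (λ {x} (i , x∈i) → sound (splitAt n i) x x∈i)
            , (λ {x} x∈S → let c , x∈c = complete x x∈S in
                 join n k c , subst (λ d → x ∈ C d) (sym (splitAt-join n k c)) x∈c)
    } , λ i → good (splitAt n i)

class-unique : ∀ {S : Pred ℕ 0ℓ} {n} {P : Fin n → Pred ℕ 0ℓ} → IsPartition S P →
  ∀ {i j x} → x ∈ P i → x ∈ P j → i ≡ j
class-unique part {i} {j} x∈i x∈j with i ≟ᶠ j
... | yes i≡j = i≡j
... | no  i≢j = ⊥-elim (IsPartition.disjoint part i j i≢j (x∈i , x∈j))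

module Construction (p q n k : ℕ)
  (A : Fin n → Pred ℕ 0ℓ) (A-partition : IsPartition ⟦1⋯ q ⟧ A) (A-weak : ∀ i → WeaklySumFree (A i))
  (B : Fin k → Pred ℕ 0ℓ) (B-partition : IsPartition ⟦1⋯ p ⟧ B) (B-free : ∀ j → SumFree (B j))
  where

  -- Constants and their inequalities

  open ≤-Reasoning

  r s a : ℕ
  r = ⌈ q /2⌉
  s = ⌊ q /2⌋
  a = q + r + 1

  module A = IsPartition A-partition
  module B = IsPartition B-partition

  s+r≡q : s + r ≡ q
  s+r≡q = ⌊n/2⌋+⌈n/2⌉≡n q

  r≤q : r ≤ q
  r≤q = ⌈n/2⌉≤n q

  q+r<a : q + r < a
  q+r<a = ≤-reflexive (+-comm 1 (q + r))

  -- Supplies a hypothesis of `quotient-unique` whenever one side is already a reduced remainder,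
  -- whatever the other side is.
  ≤q+r⇒<+a : ∀ {u} v → u ≤ q + r → u < v + a
  ≤q+r⇒<+a v u≤q+r = ≤-trans (≤-<-trans u≤q+r q+r<a) (m≤n+m a v)

  ≤q⇒≤q+r : ∀ {u} → u ≤ q → u ≤ q + r
  ≤q⇒≤q+r u≤q = ≤-trans u≤q (m≤m+n q r)

  s<u⇒q<u+r : ∀ {u} → s < u → q < u + r
  s<u⇒q<u+r {u} s<u = subst (_< u + r) s+r≡q (+-monoˡ-< r s<u)

  q<2+2s : q < suc s + suc s
  q<2+2s = s≤s (begin
    q          ≡⟨ s+r≡q ⟨
    s + r      ≤⟨ +-monoʳ-≤ s (⌈n/2⌉≤1+⌊n/2⌋ q) ⟩
    s + suc s  ∎)

  -- Excludes a carry when two `high` elements are added: their shifted remainders total at most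
  -- `2q`. It rests on `s ≤ r`, that is, on rounding `q/2` up in `a`.
  2q<a+r : q + q < a + r
  2q<a+r = begin-strict
    q + q        ≡⟨ cong (q +_) s+r≡q ⟨
    q + (s + r)  ≤⟨ +-monoʳ-≤ q (+-monoˡ-≤ r (⌊n/2⌋≤⌈n/2⌉ q)) ⟩
    q + (r + r)  ≡⟨ +-assoc q r r ⟨
    q + r + r    <⟨ +-monoˡ-< r q+r<a ⟩
    a + r        ∎

  -- In `high` the remainder is v = u + r, so that −r ≤ u ≤ s becomes 0 ≤ v ≤ q.
  data Class : Fin n ⊎ Fin k → Pred ℕ 0ℓ where
    low  : ∀ {i x} m u → x ≡ u + m * a → m ≤ p → u ∈ A i → m ≡ 0 ⊎ s < u → Class (inj₁ i) x
    high : ∀ {j x} m v → x + r ≡ v + m * a → v ≤ q → m ∈ B j → Class (inj₂ j) x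

  A-bounds : ∀ {i u} → u ∈ A i → 1 ≤ u × u ≤ q
  A-bounds u∈A = proj₁ A.union (_ , u∈A)

  B-bounds : ∀ {j m} → m ∈ B j → 1 ≤ m × m ≤ p
  B-bounds m∈B = proj₁ B.union (_ , m∈B)

  -- The classes partition the interval

  satisfiable : ∀ c → Satisfiable (Class c)
  satisfiable (inj₁ i) with u , u∈A ← A.nonempty i =
    u , low 0 u (sym (+-identityʳ u)) z≤n u∈A (inj₁ refl)
  satisfiable (inj₂ j) with m , m∈B ← B.nonempty j =
    -- The multiple of `a` has true remainder 0, hence shifted remainder `r`.
    m * a , high m r (+-comm (m * a) r) r≤q m∈B

  -- After shifting the `low` element by `r` as well, either its quotient is 0 while the `high` one
  -- is positive, or its shifted remainder exceeds `s + r = q`, the bound for `high`.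
  low∩high : ∀ {i j x} → x ∈ Class (inj₁ i) → x ∈ Class (inj₂ j) → ⊥
  low∩high {x = x} (low m u x≡ _ u∈A m≡0⊎s<u) (high m′ v x+r≡ v≤q m′∈B) = absurd m≡0⊎s<u
    where
    u≤q : u ≤ q
    u≤q = proj₂ (A-bounds u∈A)

    eq : (u + r) + m * a ≡ v + m′ * a
    eq = trans (move u r (m * a)) (trans (cong (_+ r) (sym x≡)) x+r≡)
      where
      move : ∀ u r w → (u + r) + w ≡ (u + w) + r
      move = solve-∀

    u+r<v+a : u + r < v + a
    u+r<v+a = ≤q+r⇒<+a v (+-monoˡ-≤ r u≤q)

    v<u+r+a : v < u + r + a
    v<u+r+a = ≤q+r⇒<+a (u + r) (≤q⇒≤q+r v≤q)

    absurd : m ≡ 0 ⊎ s < u → ⊥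
    absurd (inj₁ m≡0) = <⇒≢ (proj₁ (B-bounds m′∈B))
      (trans (sym m≡0) (quotient-unique m m′ u+r<v+a v<u+r+a eq))
    absurd (inj₂ s<u) = <⇒≱ (s<u⇒q<u+r s<u)
      (subst (_≤ q) (sym (remainder-unique m m′ u+r<v+a v<u+r+a eq)) v≤q)

  unique : ∀ c d x → x ∈ Class c → x ∈ Class d → c ≡ d
  unique (inj₁ i) (inj₁ i′) x (low m u x≡ _ u∈A _) (low m′ u′ x≡′ _ u′∈A _) =
    cong inj₁ (class-unique A-partition u∈A (subst (_∈ A i′) (sym u≡u′) u′∈A))
    where
    u≡u′ : u ≡ u′
    u≡u′ = remainder-unique m m′
      (≤q+r⇒<+a u′ (≤q⇒≤q+r (proj₂ (A-bounds u∈A))))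
      (≤q+r⇒<+a u (≤q⇒≤q+r (proj₂ (A-bounds u′∈A))))
      (trans (sym x≡) x≡′)
  unique (inj₁ _) (inj₂ _) _ x∈low x∈high = ⊥-elim (low∩high x∈low x∈high)
  unique (inj₂ _) (inj₁ _) _ x∈high x∈low = ⊥-elim (low∩high x∈low x∈high)
  unique (inj₂ j) (inj₂ j′) x (high m v x+r≡ v≤q m∈B) (high m′ v′ x+r≡′ v′≤q m′∈B) =
    cong inj₂ (class-unique B-partition m∈B (subst (_∈ B j′) (sym m≡m′) m′∈B))
    where
    m≡m′ : m ≡ m′
    m≡m′ = quotient-unique m m′
      (≤q+r⇒<+a v′ (≤q⇒≤q+r v≤q)) (≤q+r⇒<+a v (≤q⇒≤q+r v′≤q))
      (trans (sym x+r≡) x+r≡′)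

  sound : ∀ c x → x ∈ Class c → x ∈ ⟦1⋯ p * a + q ⟧
  sound (inj₁ i) x (low m u refl m≤p u∈A _) with 1≤u , u≤q ← A-bounds u∈A =
    ≤-trans 1≤u (m≤m+n u (m * a)) , (begin
      u + m * a  ≤⟨ +-mono-≤ u≤q (*-monoˡ-≤ a m≤p) ⟩
      q + p * a  ≡⟨ +-comm q (p * a) ⟩
      p * a + q  ∎)
  sound (inj₂ j) x (high m v x+r≡ v≤q m∈B) with 1≤m , m≤p ← B-bounds m∈B =
    +-cancelʳ-≤ r 1 x (begin
      1 + r        ≤⟨ s≤s (m≤n+m r q) ⟩
      1 + (q + r)  ≤⟨ q+r<a ⟩
      a            ≡⟨ *-identityˡ a ⟨
      1 * a        ≤⟨ *-monoˡ-≤ a 1≤m ⟩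
      m * a        ≤⟨ m≤n+m (m * a) v ⟩
      v + m * a    ≡⟨ x+r≡ ⟨
      x + r        ∎)
    , (begin
      x          ≤⟨ m≤m+n x r ⟩
      x + r      ≡⟨ x+r≡ ⟩
      v + m * a  ≤⟨ +-mono-≤ v≤q (*-monoˡ-≤ a m≤p) ⟩
      q + p * a  ≡⟨ +-comm q (p * a) ⟩
      p * a + q  ∎)

  -- Here `v` is the remainder shifted by `r`. Since `q = s + r`, the test `v ≤ q` decides whether
  -- the true remainder is at most `s`; when it fails, `v ∸ r` is a genuine subtraction.
  classify : ∀ m v x → 1 ≤ x → x + r ≡ v + m * a → v ≤ q + r → m ≤ p → ∃[ c ] x ∈ Class c
  classify m v x 1≤x x+r≡ v≤q+r m≤p with v ≤? q
  -- With quotient 0, `x` is at most `v` and so at most `q`: it is its own remainder.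
  classify zero v x 1≤x x+r≡ _ _ | yes v≤q =
    let i , x∈A = proj₂ A.union (1≤x , (begin
          x      ≤⟨ m≤m+n x r ⟩
          x + r  ≡⟨ x+r≡ ⟩
          v + 0  ≡⟨ +-identityʳ v ⟩
          v      ≤⟨ v≤q ⟩
          q      ∎))
    in inj₁ i , low 0 x (sym (+-identityʳ x)) z≤n x∈A (inj₁ refl)
  classify (suc m) v x _ x+r≡ _ m≤p | yes v≤q =
    let j , m∈B = proj₂ B.union (s≤s z≤n , m≤p) in inj₂ j , high (suc m) v x+r≡ v≤q m∈B
  classify m v x _ x+r≡ v≤q+r m≤p | no v≰q =
    let i , u∈A = proj₂ A.union (≤-trans (s≤s z≤n) s<u , u≤q)
    in inj₁ i , low m u x≡ m≤p u∈A (inj₂ s<u)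
    where
    u : ℕ
    u = v ∸ r

    u+r≡v : u + r ≡ v
    u+r≡v = m∸n+n≡m (≤-trans r≤q (<⇒≤ (≰⇒> v≰q)))

    s<u : s < u
    s<u = +-cancelʳ-< r s u (subst₂ _<_ (sym s+r≡q) (sym u+r≡v) (≰⇒> v≰q))

    u≤q : u ≤ q
    u≤q = +-cancelʳ-≤ r u q (subst (_≤ q + r) (sym u+r≡v) v≤q+r)

    move : ∀ u r w → (u + r) + w ≡ (u + w) + r
    move = solve-∀

    x≡ : x ≡ u + m * a
    x≡ = +-cancelʳ-≡ r x (u + m * a)
      (trans x+r≡ (trans (cong (_+ m * a) (sym u+r≡v)) (move u r (m * a))))

  complete : ∀ x → x ∈ ⟦1⋯ p * a + q ⟧ → ∃[ c ] x ∈ Class c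
  complete x (1≤x , x≤) = classify m v x 1≤x x+r≡ v≤q+r (s≤s⁻¹ (*-cancelʳ-< a m (suc p) m*a<))
    where
    instance
      a-nonZero : NonZero a
      a-nonZero = >-nonZero (≤-<-trans z≤n q+r<a)

    m v : ℕ
    m = (x + r) / a
    v = (x + r) % a

    x+r≡ : x + r ≡ v + m * a
    x+r≡ = m≡m%n+[m/n]*n (x + r) a

    v≤q+r : v ≤ q + r
    v≤q+r = s≤s⁻¹ (subst (v <_) (+-comm (q + r) 1) (m%n<n (x + r) a))

    -- The endpoint `p * a + q` shifted by `r` still falls short of `suc p * a`, which keeps the
    -- quotient at most `p`.
    m*a< : m * a < suc p * a
    m*a< = begin-strict
      m * a            ≤⟨ m≤n+m (m * a) v ⟩
      v + m * a        ≡⟨ x+r≡ ⟨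
      x + r            ≤⟨ +-monoˡ-≤ r x≤ ⟩
      p * a + q + r    ≡⟨ +-assoc (p * a) q r ⟩
      p * a + (q + r)  <⟨ +-monoʳ-< (p * a) q+r<a ⟩
      p * a + a        ≡⟨ +-comm (p * a) a ⟩
      suc p * a        ∎

  -- Weak sum-freeness of the classes

  weaklySumFree : ∀ c → WeaklySumFree (Class c)
  weaklySumFree (inj₁ i) x y (low m u x≡ _ u∈A small) (low m′ u′ y≡ _ u′∈A small′) x≢y
    (low m″ u″ x+y≡ _ u″∈A small″) =
    A-weak i u u′ u∈A u′∈A (u≢u′ small small′) (subst (_∈ A i) (sym u+u′≡u″) u″∈A)
    where
    u″≤q : u″ ≤ q
    u″≤q = proj₂ (A-bounds u″∈A)

    eq : (u + u′) + (m + m′) * a ≡ u″ + m″ * a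
    eq = trans (sym (+-quotients u u′ m m′ a)) (trans (sym (cong₂ _+_ x≡ y≡)) x+y≡)

    -- If the sum has quotient 0, it equals `u″` and bounds `u + u′` outright. Otherwise `u″ + r`
    -- exceeds `q`, which absorbs one of the two remainders, and `a` absorbs the other.
    u+u′<u″+a : m″ ≡ 0 ⊎ s < u″ → u + u′ < u″ + a
    u+u′<u″+a (inj₁ refl) = begin-strict
      u + u′                   ≤⟨ m≤m+n (u + u′) ((m + m′) * a) ⟩
      u + u′ + (m + m′) * a    ≡⟨ eq ⟩
      u″ + 0                   <⟨ +-monoʳ-< u″ (≤-<-trans z≤n q+r<a) ⟩
      u″ + a                   ∎
    u+u′<u″+a (inj₂ s<u″) = begin-strict
      u + u′                   ≤⟨ +-mono-≤ (proj₂ (A-bounds u∈A)) (proj₂ (A-bounds u′∈A)) ⟩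
      q + q                    <⟨ +-monoʳ-< q (s<u⇒q<u+r s<u″) ⟩
      q + (u″ + r)             ≡⟨ swap q u″ r ⟩
      u″ + (q + r)             ≤⟨ +-monoʳ-≤ u″ (<⇒≤ q+r<a) ⟩
      u″ + a                   ∎
      where
      swap : ∀ q u r → q + (u + r) ≡ u + (q + r)
      swap = solve-∀

    u+u′≡u″ : u + u′ ≡ u″
    u+u′≡u″ = remainder-unique (m + m′) m″ (u+u′<u″+a small″)
      (≤q+r⇒<+a (u + u′) (≤q⇒≤q+r u″≤q)) eq

    s<u⇒u≢u′ : s < u → u ≢ u′
    s<u⇒u≢u′ s<u u≡u′ = <⇒≱ q<2+2s (begin
      suc s + suc s  ≤⟨ +-mono-≤ s<u (subst (s <_) u≡u′ s<u) ⟩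
      u + u′         ≡⟨ u+u′≡u″ ⟩
      u″             ≤⟨ u″≤q ⟩
      q              ∎)

    u≢u′ : m ≡ 0 ⊎ s < u → m′ ≡ 0 ⊎ s < u′ → u ≢ u′
    u≢u′ (inj₁ refl) (inj₁ refl) u≡u′ = x≢y (trans x≡ (trans (cong (_+ 0) u≡u′) (sym y≡)))
    u≢u′ (inj₂ s<u)  _           u≡u′ = s<u⇒u≢u′ s<u u≡u′
    u≢u′ (inj₁ _)    (inj₂ s<u′) u≡u′ = s<u⇒u≢u′ (subst (s <_) (sym u≡u′) s<u′) u≡u′
  weaklySumFree (inj₂ j) x y (high m v x+r≡ v≤q m∈B) (high m′ v′ y+r≡ v′≤q m′∈B) _
    (high m″ v″ x+y+r≡ v″≤q m″∈B) = B-free j m m′ m∈B m′∈B (subst (_∈ B j) (sym m+m′≡m″) m″∈B)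
    where
    -- The summands bring in the shift `r` twice and their sum only once, so one more `r` is added
    -- beside `v″`.
    eq : (v + v′) + (m + m′) * a ≡ (v″ + r) + m″ * a
    eq = begin-equality
      (v + v′) + (m + m′) * a      ≡⟨ +-quotients v v′ m m′ a ⟨
      (v + m * a) + (v′ + m′ * a)  ≡⟨ cong₂ _+_ x+r≡ y+r≡ ⟨
      (x + r) + (y + r)            ≡⟨ move x y r ⟩
      r + ((x + y) + r)            ≡⟨ cong (r +_) x+y+r≡ ⟩
      r + (v″ + m″ * a)            ≡⟨ move′ r v″ (m″ * a) ⟩
      (v″ + r) + m″ * a            ∎
      where
      move : ∀ x y r → (x + r) + (y + r) ≡ r + ((x + y) + r)
      move = solve-∀

      move′ : ∀ r v w → r + (v + w) ≡ (v + r) + w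
      move′ = solve-∀

    -- Distinct `x` and `y` may share a quotient, so the contradiction comes from sum-freeness with
    -- `m = m′` allowed.
    m+m′≡m″ : m + m′ ≡ m″
    m+m′≡m″ = quotient-unique (m + m′) m″
      (begin-strict
        v + v′        ≤⟨ +-mono-≤ v≤q v′≤q ⟩
        q + q         <⟨ 2q<a+r ⟩
        a + r         ≡⟨ +-comm a r ⟩
        r + a         ≤⟨ +-monoˡ-≤ a (m≤n+m r v″) ⟩
        (v″ + r) + a  ∎)
      (≤q+r⇒<+a (v + v′) (+-monoˡ-≤ r v″≤q)) eq

theorem3p1 : (p k q n : ℕ) .{{_ : NonZero p}} .{{_ : NonZero k}} .{{_ : NonZero q}} .{{_ : NonZero n}} →
    ⟦1⋯ q ⟧ PartitionableInto n Subsets WeaklySumFree →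
    ⟦1⋯ p ⟧ PartitionableInto k Subsets SumFree →
    ⟦1⋯ p * (q + ⌈ q /2⌉ + 1) + q ⟧ PartitionableInto (n + k) Subsets WeaklySumFree
theorem3p1 p k q n (A , A-partition , A-weak) (B , B-partition , B-free) =
  reindex-splitAt WeaklySumFree n k Class satisfiable unique sound complete weaklySumFree
  where open Construction p q n k A A-partition A-weak B B-partition B-free
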